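{- Let $k$ be a positive integer and let $I$ be a complete bipartite preference structure of size $k$. A strong polyhedral realization of (the underlying two-sided agent structure of) $I$ exists if and only if $k=4$. In that case (i.e. when $k=4$), the underlying graph of a strong polyhedral realization is isomorphic to the cube graph $Q_3$.
   Context: All graphs are finite and simple. A complete bipartite preference structure of size $k$ is a tuple $I=(M,W,\{\succ_m\}_{m\in M},\{\succ_w\}_{w\in W})$, where $M$ and $W$ are disjoint finite sets with $|M|=|W|=k$, each $\succ_m$ is a strict total order on $W$, and each $\succ_w$ is a strict total order on $M$. A polyhedral graph is the graph (vertices and edges) of a convex three-dimensional polyhedron; equivalently, by Steinitz's theorem, a planar 3-connected graph. A strong polyhedral realization of the underlying two-sided agent structure of $I$ consists of a bipartite polyhedral graph $G=(V_M\sqcup V_W,E)$ with bipartition classes $V_M,V_W$ satisfying $|V_M|=|V_W|=k$, together with bijections $M\to V_M$ and $W\to V_W$, such that each vertex is adjacent to exactly $k-1$ vertices of the opposite bipartition class. (The preference orders play no role in this condition.) The cube graph $Q_3$ has vertex set $\{0,1\}^3$, two vertices being adjacent if and only if they differ in exactly one coordinate. -}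

module Defs where

open import Data.Fin.Base using (Fin; suc)
open import Data.Fin.Patterns using (0F)
open import Data.Fin.Properties using (*↔×; _≟_)
open import Data.List.Base using (List; length)
open import Data.List.Membership.Propositional using (_∉_)
open import Data.Nat.Base using (ℕ; zero; suc; _+_; _*_; _∸_; _^_; _<_)
import Data.Nat.Properties as ℕ
open import Data.Nat.GeneralisedArithmetic using (iterate)
open import Data.Product.Base using (∃; _×_; _,_)
open import Data.Product.Function.NonDependent.Propositional using (_×-↔_)
open import Data.Refinement using (Refinement-syntax)
open import Data.Sum.Base using (_⊎_; inj₁; inj₂)
open import Data.Vec.Base using (Vec; []; _∷_; zip; count)
open import Function.Bundles using (_↔_; _⇔_; Inverse; mk↔ₛ′)
open import Function.Construct.Composition using (_↔-∘_)
open import Function.Construct.Identity using (↔-id)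
open import Function.Construct.Symmetry using (↔-sym)
open import Function.Definitions using (Injective; Surjective)
open import Level using (0ℓ)
open import Relation.Binary.Construct.Closure.ReflexiveTransitive using (Star)
open import Relation.Binary.Core using (Rel)
open import Relation.Binary.Definitions using (Decidable; Symmetric; Irreflexive)
open import Relation.Binary.PropositionalEquality
  using (_≡_; refl; sym; trans; cong)
open import Relation.Binary.Structures using (IsStrictTotalOrder)
open import Relation.Nullary.Decidable using (yes; no; ¬?)
open import Relation.Nullary.Negation using (¬_; contradiction)

-- M and W are distinct types, so the two sides are automatically disjoint.
record PreferenceStructure (k : ℕ) : Set₁ where
  field
    M W   : Set
    sizeM : M ↔ Fin k
    sizeW : W ↔ Fin k
    prefM : M → Rel W 0ℓ
    prefW : W → Rel M 0ℓ
    prefM-isStrictTotalOrder : ∀ m → IsStrictTotalOrder _≡_ (prefM m)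
    prefW-isStrictTotalOrder : ∀ w → IsStrictTotalOrder _≡_ (prefW w)

------------------------------------------------------------------------
-- Graphs

record Graph (V : Set) : Set₁ where
  infix 4 _~_ _~?_
  field
    order    : ℕ
    finite   : V ↔ Fin order
    _~_      : Rel V 0ℓ
    _~?_     : Decidable _~_
    ~-sym    : Symmetric _~_
    ~-irrefl : Irreflexive _≡_ _~_

infix 4 _≅_
_≅_ : {V V′ : Set} → Graph V → Graph V′ → Set
_≅_ {V} {V′} G H =
  ∃ λ (f : V ↔ V′) → ∀ u v → (u G.~ v) ⇔ (Inverse.to f u H.~ Inverse.to f v)
  where
  module G = Graph G
  module H = Graph H

module _ {V : Set} (G : Graph V) where
  open Graph G

  Avoiding : List V → Rel V 0ℓ
  Avoiding S u v = u ∉ S × v ∉ S × u ~ v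

  -- More than k vertices, and G − S is connected whenever ∣S∣ < k; since
  -- lists may repeat entries, they represent exactly the sets of size < k.
  Connected[_] : ℕ → Set
  Connected[ k ] =
    k < order ×
    (∀ S → length S < k → ∀ u v → u ∉ S → v ∉ S → Star (Avoiding S) u v)

  -- An edge with a direction.  The adjacency proof is irrelevant, so there is
  -- exactly one dart for each ordered pair of adjacent vertices.
  record Dart : Set where
    constructor dart
    field
      tail head : V
      .edge     : tail ~ head

------------------------------------------------------------------------
-- Planarity

-- R is an equivalence relation with exactly n classes.
record Classes {A : Set} (R : Rel A 0ℓ) (n : ℕ) : Set where
  field
    class      : A → Fin n
    surjective : Surjective _≡_ _≡_ class
    class-≡    : ∀ x y → (class x ≡ class y) ⇔ R x y

-- For a permutation of a finite set this is the relation "in the same cycle".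
Orbit : {A : Set} → (A → A) → Rel A 0ℓ
Orbit f x y = ∃ λ n → iterate f x n ≡ y

-- Planarity in the sense of combinatorial maps: a rotation system (a cyclic
-- order of the darts leaving each vertex) describes a cellular embedding of
-- each component that has an edge into a closed orientable surface, whose faces
-- are the orbits of d ↦ next (reverse d).  Writing n, e, f, c for the numbers
-- of vertices, edges, faces and components, each component satisfies
-- n − e + f = 2 − 2g with g ≥ 0 its genus, so n − e + f = 2c holds exactly when
-- all of these surfaces are spheres.  Everything is counted on darts, so
-- isolated vertices, irrelevant for planarity, are left out of both n and c.
module _ {V : Set} (G : Graph V) where
  open Graph G
  open Dart

  reverse : Dart G → Dart G
  reverse (dart u v e) = dart v u (~-sym e)

  SameTail SameEdge SameComponent : Rel (Dart G) 0ℓ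
  SameTail      d e = tail d ≡ tail e
  SameEdge      d e = d ≡ e ⊎ reverse d ≡ e
  SameComponent d e = Star _~_ (tail d) (tail e)

  record Planar : Set where
    field
      next           : Dart G → Dart G
      next-injective : Injective _≡_ _≡_ next
      next-cyclic    : ∀ d e → SameTail d e ⇔ Orbit next d e

    SameFace : Rel (Dart G) 0ℓ
    SameFace = Orbit (λ d → next (reverse d))

    field
      #vertices #edges #faces #components : ℕ
      vertices   : Classes SameTail #vertices
      edges      : Classes SameEdge #edges
      faces      : Classes SameFace #faces
      components : Classes SameComponent #components
      euler      : #vertices + #faces ≡ #edges + 2 * #components

-- Graphs of convex three-dimensional polyhedra, by Steinitz's theorem.
Polyhedral : {V : Set} → Graph V → Set
Polyhedral G = Planar G × Connected[_] G 3

------------------------------------------------------------------------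
-- Strong polyhedral realizations

record StrongRealization {k : ℕ} (I : PreferenceStructure k) : Set₁ where
  open PreferenceStructure I
  field
    {V-M V-W} : Set
    graph     : Graph (V-M ⊎ V-W)
    sizeV-M   : V-M ↔ Fin k
    sizeV-W   : V-W ↔ Fin k
  open Graph graph public
  field
    independentM : ∀ u v → ¬ (inj₁ u ~ inj₁ v)
    independentW : ∀ u v → ¬ (inj₂ u ~ inj₂ v)
    polyhedral   : Polyhedral graph
    agentsM      : M ↔ V-M
    agentsW      : W ↔ V-W
    degreeM      : ∀ u → [ v ∈ V-W ∣ inj₁ u ~ inj₂ v ] ↔ Fin (k ∸ 1)
    degreeW      : ∀ v → [ u ∈ V-M ∣ inj₂ v ~ inj₁ u ] ↔ Fin (k ∸ 1)

------------------------------------------------------------------------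
-- The cube graph

Vec↔Fin : ∀ m n → Vec (Fin m) n ↔ Fin (m ^ n)
Vec↔Fin m zero    = mk↔ₛ′ (λ _ → 0F) (λ _ → []) (λ { 0F → refl ; (suc ()) }) (λ { [] → refl })
Vec↔Fin m (suc n) = ↔-sym *↔× ↔-∘ ((↔-id _ ×-↔ Vec↔Fin m n) ↔-∘ uncons↔)
  where
  uncons↔ : Vec (Fin m) (suc n) ↔ (Fin m × Vec (Fin m) n)
  uncons↔ = mk↔ₛ′ (λ { (x ∷ xs) → x , xs }) (λ { (x , xs) → x ∷ xs })
                   (λ _ → refl) (λ { (x ∷ xs) → refl })

-- The number of coordinates in which two vectors differ.
hamming : ∀ {m n} → Vec (Fin m) n → Vec (Fin m) n → ℕ
hamming xs ys = count (λ { (x , y) → ¬? (x ≟ y) }) (zip xs ys)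

hamming-sym : ∀ {m n} (xs ys : Vec (Fin m) n) → hamming xs ys ≡ hamming ys xs
hamming-sym []       []       = refl
hamming-sym (x ∷ xs) (y ∷ ys) with x ≟ y | y ≟ x
... | yes _   | yes _   = hamming-sym xs ys
... | yes x≡y | no  y≢x = contradiction (sym x≡y) y≢x
... | no  x≢y | yes y≡x = contradiction (sym y≡x) x≢y
... | no  _   | no  _   = cong suc (hamming-sym xs ys)

hamming-refl : ∀ {m n} (xs : Vec (Fin m) n) → hamming xs xs ≡ 0
hamming-refl []       = refl
hamming-refl (x ∷ xs) with x ≟ x
... | yes _   = hamming-refl xs
... | no  x≢x = contradiction refl x≢x

Q₃ : Graph (Vec (Fin 2) 3)
Q₃ = record
  { order    = 8
  ; finite   = Vec↔Fin 2 3
  ; _~_      = λ u v → hamming u v ≡ 1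
  ; _~?_     = λ u v → hamming u v ℕ.≟ 1
  ; ~-sym    = λ {u} {v} → trans (hamming-sym v u)
  ; ~-irrefl = λ { {u} refl h → contradiction (trans (sym (hamming-refl u)) h) λ () }
  }

{-# OPTIONS --safe #-}

-- Deleting the k − 1 neighbours of a vertex isolates it, so 3-connectivity forces
-- k ≥ 4.  On the other hand every face of a bipartite graph without leaves has at least
-- four darts, whence 2f ≤ e and Euler's formula gives e + 4 ≤ 2n; with n = 2k and
-- e = k(k − 1) this is (k − 1)(k − 4) ≤ 0.  For k = 4 each vertex has exactly one
-- non-neighbour on the other side, so the graph is K₄,₄ minus a perfect matching,
-- which is the cube, the matching being the pairs of antipodal vertices.

module Submission where

open import Defs
open import Data.Bool.Base using (Bool; true; false; not)
import Data.Bool.Properties as Bool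
open import Data.Empty using (⊥)
open import Data.Fin.Base using (Fin; suc; toℕ; combine; punchIn; punchOut)
open import Data.Fin.Patterns using (0F; 1F; 2F; 3F; 4F; 5F)
open import Data.Fin.Permutation using (↔⇒≡)
open import Data.Fin.Properties
  using (any?; all?; nonZeroIndex; injective⇒≤; +↔⊎; *↔×; 2↔Bool; punchInᵢ≢i;
         punchIn-punchOut; punchOut-punchIn)
  renaming (_≟_ to _≟F_)
open import Data.Irrelevant using ([_])
open import Data.List.Base using (List; []; _∷_; length)
import Data.List.Base as List
import Data.List.Membership.DecPropositional as DecMembership
open import Data.List.Membership.Propositional using (_∈_; _∉_)
open import Data.List.Membership.Propositional.Properties using (∈-tabulate⁺; ∈-tabulate⁻)
import Data.List.Properties as List
open import Data.Nat.Base
  using (ℕ; zero; suc; _+_; _*_; _∸_; _≤_; _<_; z≤n; s≤s; NonZero; >-nonZero⁻¹)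
import Data.Nat.Properties as ℕ
open import Data.Nat.GeneralisedArithmetic using (iterate)
open import Data.Nat.Tactic.RingSolver using (solve-∀)
open import Data.Product.Base using (∃; _×_; _,_; proj₁; proj₂)
open import Data.Product.Function.NonDependent.Propositional using (_×-↔_)
open import Data.Refinement using (Refinement-syntax; _,_; value; value-injective)
open import Data.Sum.Base using (_⊎_; inj₁; inj₂; [_,_]′)
open import Data.Sum.Function.Propositional using (_⊎-↔_)
open import Data.Sum.Properties using (inj₁-injective; inj₂-injective)
open import Data.Vec.Base using (Vec; []; _∷_; lookup)
import Data.Vec.Base as Vec
import Data.Vec.Relation.Unary.All as All
import Data.Vec.Relation.Unary.AllPairs as AllPairs
open import Data.Vec.Relation.Unary.Unique.Propositional using (Unique)
open import Data.Vec.Relation.Unary.Unique.Propositional.Properties using (lookup-injective)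
open import Function.Base using (_∘_; id; const)
open import Function.Bundles
  using (_↔_; _⇔_; Inverse; Equivalence; module Injection; mk↔ₛ′; mk⇔)
open import Function.Consequences.Propositional using (strictlySurjective⇒surjective)
open import Function.Construct.Composition using (_↔-∘_; _⇔-∘_)
open import Function.Construct.Identity using (↔-id)
open import Function.Construct.Symmetry using (↔-sym)
open import Function.Definitions using (Injective)
open import Function.Properties.Inverse using (↔⇒↣)
open import Level using (0ℓ)
open import Relation.Binary.Construct.Closure.ReflexiveTransitive using (Star; ε; _◅_)
import Relation.Binary.Construct.Closure.ReflexiveTransitive as Star
open import Relation.Binary.Core using (Rel)
open import Relation.Binary.Definitions using (DecidableEquality)
  renaming (Decidable to Decidable₂)
open import Relation.Binary.PropositionalEquality
  using (_≡_; _≢_; refl; sym; trans; cong; subst; ≢-sym; module ≡-Reasoning)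
open import Relation.Nullary.Decidable
  using (Dec; yes; no; ¬?; map′; via-injection; recompute; from-yes; _→-dec_; _×-dec_;
         _⊎-dec_; decidable-stable)
open import Relation.Nullary.Negation using (¬_; contradiction; contradiction-irr)
open import Relation.Unary using (Pred; Decidable)

-- Counting

to-injective : ∀ {A B : Set} (f : A ↔ B) → Injective _≡_ _≡_ (Inverse.to f)
to-injective f = Injection.injective (↔⇒↣ f)

module _ {A B : Set} {m n} (#A : A ↔ Fin m) (#B : B ↔ Fin n) where

  injective⇒size≤ : ∀ {f : A → B} → Injective _≡_ _≡_ f → m ≤ n
  injective⇒size≤ inj =
    injective⇒≤ (to-injective (↔-sym #A) ∘ inj ∘ to-injective #B)

module _ {A : Set} {n} (#A : A ↔ Fin n) where

  finite-≟ : DecidableEquality A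
  finite-≟ = via-injection (↔⇒↣ #A) _≟F_

  module _ {P : Pred A 0ℓ} (P? : Decidable P) where

    finite-all? : Dec (∀ a → P a)
    finite-all? = map′
      (λ ∀P a → subst P (Inverse.strictlyInverseʳ #A a) (∀P (Inverse.to #A a)))
      (_∘ Inverse.from #A)
      (all? (P? ∘ Inverse.from #A))

    finite-any? : Dec (∃ P)
    finite-any? = map′
      (λ (i , p) → Inverse.from #A i , p)
      (λ (a , p) → Inverse.to #A a , subst P (sym (Inverse.strictlyInverseʳ #A a)) p)
      (any? (P? ∘ Inverse.from #A))

module _ {A : Set} {n} (#A : A ↔ Fin (suc n))
         {P : Pred A 0ℓ} (P? : Decidable P) (#P : [ a ∈ A ∣ P a ] ↔ Fin n) where

  -- Pigeonhole: if `P` held everywhere, `suc n` elements would inject into a subtype with `n`.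
  exception : ∃ λ a → ¬ P a
  exception with finite-any? #A (¬? ∘ P?)
  ... | yes ∃¬P = ∃¬P
  ... | no ∄¬P = contradiction (injective⇒size≤ #A #P {total} (cong value)) (ℕ.<-irrefl refl)
    where
    total : A → [ a ∈ A ∣ P a ]
    total a = a , [ decidable-stable (P? a) (∄¬P ∘ (a ,_)) ]

  -- Two distinct exceptions and the `n` elements satisfying `P` would be `n + 2` distinct elements
  -- of `A`.
  exception-unique : ∀ {a b} → ¬ P a → ¬ P b → a ≡ b
  exception-unique {a} {b} ¬Pa ¬Pb with finite-≟ #A a b
  ... | yes a≡b = a≡b
  ... | no  a≢b =
    contradiction (injective⇒size≤ (↔-sym +↔⊎ ↔-∘ (↔-id (Fin 2) ⊎-↔ #P)) #A f-injective)
                  (ℕ.<-irrefl refl)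
    where
    f : Fin 2 ⊎ [ a ∈ A ∣ P a ] → A
    f (inj₁ 0F) = a
    f (inj₁ 1F) = b
    f (inj₂ p)  = value p

    f-injective : Injective _≡_ _≡_ f
    f-injective {inj₁ 0F}          {inj₁ 0F}          _    = refl
    f-injective {inj₁ 0F}          {inj₁ 1F}          eq   = contradiction eq a≢b
    f-injective {inj₁ 1F}          {inj₁ 0F}          eq   = contradiction (sym eq) a≢b
    f-injective {inj₁ 1F}          {inj₁ 1F}          _    = refl
    f-injective {inj₁ 0F}          {inj₂ (_ , [ p ])} refl = contradiction-irr p ¬Pa
    f-injective {inj₁ 1F}          {inj₂ (_ , [ p ])} refl = contradiction-irr p ¬Pb
    f-injective {inj₂ (_ , [ p ])} {inj₁ 0F}          refl = contradiction-irr p ¬Pa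
    f-injective {inj₂ (_ , [ p ])} {inj₁ 1F}          refl = contradiction-irr p ¬Pb
    f-injective {inj₂ _}           {inj₂ _}           eq   = cong inj₂ (value-injective eq)

-- Euler's bound for bipartite planar graphs

module _ {V : Set} {G : Graph V} where
  open Graph G
  open Dart

  dart-≡ : ∀ {d e : Dart G} → tail d ≡ tail e → head d ≡ head e → d ≡ e
  dart-≡ refl refl = refl

  _≟D_ : DecidableEquality (Dart G)
  d ≟D e = map′ (λ (p , q) → dart-≡ p q) (λ { refl → refl , refl })
                (finite-≟ finite (tail d) (tail e) ×-dec finite-≟ finite (head d) (head e))

  -- Darts are searched through ordered pairs of vertices, without being enumerated themselves; a
  -- non-adjacent pair holds vacuously.
  all-darts? : {P : Pred (Dart G) 0ℓ} → Decidable P → Dec (∀ d → P d)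
  all-darts? {P} P? = map′ {A = ∀ u v → OnEdge u v}
    (λ { f (dart u v e) → f u v e }) (λ f u v e → f (dart u v e))
    (finite-all? finite λ u → finite-all? finite λ v → edge? u v)
    where
    OnEdge : V → V → Set
    OnEdge u v = .(e : u ~ v) → P (dart u v e)

    edge? : ∀ u v → Dec (OnEdge u v)
    edge? u v with u ~? v
    ... | yes e = map′ (λ p _ → p) (λ f → f e) (P? (dart u v e))
    ... | no ¬e = yes λ e → contradiction-irr e ¬e

  any-dart? : {P : Pred (Dart G) 0ℓ} → Decidable P → Dec (∃ P)
  any-dart? {P} P? = map′
    (λ (u , v , e , p) → dart u v e , p)
    -- The stored adjacency proof is irrelevant; deciding `u ~ v` again gives a relevant one.
    (λ { (dart u v e , p) → u , v , recompute (u ~? v) e , p })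
    (finite-any? finite λ u → finite-any? finite λ v → edge? u v)
    where
    edge? : ∀ u v → Dec (∃ λ (e : u ~ v) → P (dart u v e))
    edge? u v with u ~? v
    ... | yes e = map′ (e ,_) proj₂ (P? (dart u v e))
    ... | no ¬e = no (¬e ∘ proj₁)

module _ {V : Set} {G : Graph V} (P : Planar G) where
  open Graph G
  open Dart
  open Planar P

  -- One dart per class gives distinct tails. Isolated vertices carry no dart, hence only an
  -- inequality.
  #vertices≤order : #vertices ≤ order
  #vertices≤order = injective⇒size≤ (↔-id _) finite {tail ∘ rep} rep-injective
    where
    open Classes vertices
    rep : Fin #vertices → Dart G
    rep i = proj₁ (surjective i)
    rep-injective : Injective _≡_ _≡_ (tail ∘ rep)
    rep-injective {i} {j} eq = begin
      i              ≡⟨ proj₂ (surjective i) refl ⟨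
      class (rep i)  ≡⟨ Equivalence.from (class-≡ _ _) eq ⟩
      class (rep j)  ≡⟨ proj₂ (surjective j) refl ⟩
      j              ∎
      where open ≡-Reasoning

  faceNext : Dart G → Dart G
  faceNext = next ∘ reverse G

  tail-next : ∀ d → tail (next d) ≡ tail d
  tail-next d = sym (Equivalence.from (next-cyclic d (next d)) (1 , refl))

  -- The orbit of a fixed dart is a singleton, and by `next-cyclic` it contains every dart with that
  -- tail.
  next-fixed⇒leaf : ∀ {d e} → next d ≡ d → tail d ≡ tail e → d ≡ e
  next-fixed⇒leaf {d} {e} fixed same with Equivalence.to (next-cyclic d e) same
  ... | n , eq = trans (sym (iterate-fixed n)) eq
    where
    iterate-fixed : ∀ n → iterate next d n ≡ d
    iterate-fixed zero    = refl
    iterate-fixed (suc n) = trans (cong (λ e → iterate next e n) fixed) (iterate-fixed n)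

  module _ (colour : V → Bool) (proper : ∀ {u v : V} → u ~ v → colour v ≡ not (colour u))
           (no-leaf : ∀ (d : Dart G) → ¬ (∀ (e : Dart G) → tail d ≡ tail e → d ≡ e)) where

    private
      side : Dart G → Bool
      side = colour ∘ tail

      colour-head : ∀ d → colour (head d) ≡ not (side d)
      colour-head (dart u v e) = recompute (_ Bool.≟ _) (proper e)

      side-faceNext : ∀ d → side (faceNext d) ≡ not (side d)
      side-faceNext d = trans (cong colour (tail-next (reverse G d))) (colour-head d)

      faceWalk : Dart G → Vec (Dart G) 4
      faceWalk d = Vec.iterate faceNext d 4

      odd-distinct : ∀ {d e} → side e ≡ not (side d) → d ≢ e
      odd-distinct eq refl = Bool.not-¬ refl eq

      -- On a face of length two, `faceNext d` runs back from `head d` to `tail d`, so `next` fixes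
      -- `reverse G d` and `head d` is a leaf.
      distinct₂ : ∀ d → d ≢ faceNext (faceNext d)
      distinct₂ d eq = no-leaf (reverse G d) λ e same →
        next-fixed⇒leaf (dart-≡ (tail-next _) head-next) same
        where
        head-next : head (faceNext d) ≡ tail d
        head-next = trans (sym (tail-next (reverse G (faceNext d)))) (cong tail (sym eq))

      -- Darts one or three steps apart leave from opposite colour classes; those two steps apart
      -- are handled by `distinct₂`.
      faceWalk-unique : ∀ d → Unique (faceWalk d)
      faceWalk-unique d =
        (distinct₁ d All.∷ distinct₂ d All.∷ distinct₃ All.∷ All.[]) AllPairs.∷
        (distinct₁ d₁ All.∷ distinct₂ d₁ All.∷ All.[]) AllPairs.∷
        (distinct₁ d₂ All.∷ All.[]) AllPairs.∷
        All.[] AllPairs.∷ AllPairs.[]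
        where
        d₁ = faceNext d
        d₂ = faceNext d₁
        distinct₁ : ∀ d → d ≢ faceNext d
        distinct₁ d = odd-distinct (side-faceNext d)
        distinct₃ : d ≢ faceNext d₂
        distinct₃ = odd-distinct (begin
          side (faceNext d₂)  ≡⟨ side-faceNext d₂ ⟩
          not (side d₂)       ≡⟨ cong not (side-faceNext d₁) ⟩
          not (not (side d₁)) ≡⟨ Bool.not-involutive _ ⟩
          side d₁             ≡⟨ side-faceNext d ⟩
          not (side d)        ∎)
          where open ≡-Reasoning

      module F = Classes faces
      module E = Classes edges

      face-faceWalk : ∀ d i → F.class (lookup (faceWalk d) i) ≡ F.class d
      face-faceWalk d 0F = refl
      face-faceWalk d 1F = sym (Equivalence.from (F.class-≡ _ _) (1 , refl))
      face-faceWalk d 2F = sym (Equivalence.from (F.class-≡ _ _) (2 , refl))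
      face-faceWalk d 3F = sym (Equivalence.from (F.class-≡ _ _) (3 , refl))

      corner : Fin #faces × Fin 4 → Dart G
      corner (f , i) = lookup (faceWalk (proj₁ (F.surjective f))) i

      face-corner : ∀ f i → F.class (corner (f , i)) ≡ f
      face-corner f i = trans (face-faceWalk _ i) (proj₂ (F.surjective f) refl)

      corner-injective : Injective _≡_ _≡_ corner
      corner-injective {f , i} {g , j} eq
        with refl ← trans (sym (face-corner f i)) (trans (cong F.class eq) (face-corner g j))
        = cong (f ,_) (lookup-injective (faceWalk-unique _) i j eq)

      -- The two darts of an edge leave from opposite colour classes.
      edge×side-injective : Injective _≡_ _≡_ (λ d → E.class d , side d)
      edge×side-injective {d} {e} eq with Equivalence.to (E.class-≡ d e) (cong proj₁ eq)
      ... | inj₁ d≡e  = d≡e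
      ... | inj₂ refl = contradiction (trans (cong proj₂ eq) (colour-head d)) (Bool.not-¬ refl)

    #faces*2≤#edges : #faces * 2 ≤ #edges
    -- Sending the four chosen darts of each face to edge and side gives 4f ≤ 2e, from which a
    -- factor 2 is cancelled.
    #faces*2≤#edges = ℕ.*-cancelʳ-≤ (#faces * 2) #edges 2
      (subst (_≤ #edges * 2) (sym (ℕ.*-assoc #faces 2 2))
        (injective⇒size≤ (↔-sym *↔×) (↔-sym *↔× ↔-∘ (↔-id _ ×-↔ ↔-sym 2↔Bool))
          (corner-injective ∘ edge×side-injective)))

    -- Doubling Euler's formula and using 2f ≤ e gives 2e + 4 ≤ 2n + e. The given dart ensures that
    -- there is at least one component, since components are counted on darts.
    bipartite-planar-bound : Dart G → #edges + 4 ≤ 2 * order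
    bipartite-planar-bound d = ℕ.+-cancelˡ-≤ #edges _ _ (begin
      #edges + (#edges + 4)           ≡⟨ lhs #edges ⟩
      (#edges + 2 * 1) * 2            ≤⟨ ℕ.*-monoˡ-≤ 2 (ℕ.+-monoʳ-≤ #edges
                                           (ℕ.*-monoʳ-≤ 2 0<#components)) ⟩
      (#edges + 2 * #components) * 2  ≡⟨ cong (_* 2) euler ⟨
      (#vertices + #faces) * 2        ≤⟨ ℕ.*-monoˡ-≤ 2 (ℕ.+-monoˡ-≤ #faces #vertices≤order) ⟩
      (order + #faces) * 2            ≡⟨ rhs order #faces ⟩
      #faces * 2 + 2 * order          ≤⟨ ℕ.+-monoˡ-≤ _ #faces*2≤#edges ⟩
      #edges + 2 * order              ∎)
      where
      open ℕ.≤-Reasoning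
      lhs : ∀ e → e + (e + 4) ≡ (e + 2 * 1) * 2
      lhs = solve-∀
      rhs : ∀ n f → (n + f) * 2 ≡ f * 2 + 2 * n
      rhs = solve-∀
      0<#components : 1 ≤ #components
      0<#components = >-nonZero⁻¹ _ ⦃ nonZeroIndex (Classes.class components d) ⦄

Orbit-invariant : ∀ {A B : Set} (f : A → A) (g : A → B) → (∀ x → g (f x) ≡ g x) →
                  ∀ {x y} → Orbit f x y → g x ≡ g y
Orbit-invariant f g invariant (n , eq) = trans (sym (go n)) (cong g eq)
  where
  go : ∀ n {x} → g (iterate f x n) ≡ g x
  go zero    = refl
  go (suc n) = trans (go n) (invariant _)

-- Crown graphs

module _ {n : ℕ} where

  -- The complete bipartite graph minus the perfect matching that joins equal indices.
  CrownAdjacent : Rel (Fin n ⊎ Fin n) 0ℓ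
  CrownAdjacent (inj₁ i) (inj₂ j) = i ≢ j
  CrownAdjacent (inj₂ i) (inj₁ j) = i ≢ j
  CrownAdjacent (inj₁ _) (inj₁ _) = ⊥
  CrownAdjacent (inj₂ _) (inj₂ _) = ⊥

  crownAdjacent? : Decidable₂ CrownAdjacent
  crownAdjacent? (inj₁ i) (inj₂ j) = ¬? (i ≟F j)
  crownAdjacent? (inj₂ i) (inj₁ j) = ¬? (i ≟F j)
  crownAdjacent? (inj₁ _) (inj₁ _) = no id
  crownAdjacent? (inj₂ _) (inj₂ _) = no id

crown : ∀ n → Graph (Fin n ⊎ Fin n)
crown n = record
  { order    = n + n
  ; finite   = ↔-sym +↔⊎
  ; _~_      = CrownAdjacent
  ; _~?_     = crownAdjacent?
  ; ~-sym    = λ { {inj₁ _} {inj₂ _} → ≢-sym ; {inj₂ _} {inj₁ _} → ≢-sym }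
  ; ~-irrefl = λ { {inj₁ _} refl () ; {inj₂ _} refl () }
  }

≢-size : ∀ {n} (i : Fin (suc n)) → [ j ∈ Fin (suc n) ∣ i ≢ j ] ↔ Fin n
≢-size {n} i = mk↔ₛ′ to (λ j → punchIn i j , [ punchInᵢ≢i i j ∘ sym ])
  (λ j → punchOut-punchIn i) (λ { (j , [ i≢j ]) → value-injective (punchIn-punchOut _) })
  where
  to : [ j ∈ Fin (suc n) ∣ i ≢ j ] → Fin n
  to (j , [ i≢j ]) = punchOut {i = i} {j} (recompute (¬? (i ≟F j)) i≢j)

-- 3-connectivity of the crown graph by bounded search

module _ {V : Set} (G : Graph V) where
  open Graph G
  open DecMembership (finite-≟ finite) using (_∉?_)

  -- Walks of at most the given length: unlike `Star`, this is decided by direct recursion on the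
  -- bound.
  Reachable : ℕ → List V → Rel V 0ℓ
  Reachable zero    S u v = u ≡ v
  Reachable (suc n) S u v = u ≡ v ⊎ ∃ λ w → Avoiding G S u w × Reachable n S w v

  reachable? : ∀ n S → Decidable₂ (Reachable n S)
  reachable? zero    S u v = finite-≟ finite u v
  reachable? (suc n) S u v = finite-≟ finite u v ⊎-dec finite-any? finite λ w →
    ((u ∉? S) ×-dec ((w ∉? S) ×-dec (u ~? w))) ×-dec reachable? n S w v

  Reachable⇒Star : ∀ n {S u v} → Reachable n S u v → Star (Avoiding G S) u v
  Reachable⇒Star zero    refl                   = ε
  Reachable⇒Star (suc n) (inj₁ refl)            = ε
  Reachable⇒Star (suc n) (inj₂ (_ , step , walk)) = step ◅ Reachable⇒Star n walk

  ReachableOff : ℕ → List V → Set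
  ReachableOff n S = ∀ u v → u ∉ S → v ∉ S → Reachable n S u v

  reachableOff? : ∀ n S → Dec (ReachableOff n S)
  reachableOff? n S = finite-all? finite λ u → finite-all? finite λ v →
    (u ∉? S) →-dec ((v ∉? S) →-dec reachable? n S u v)

crown₄-3-connected : Connected[_] (crown 4) 3
crown₄-3-connected = from-yes (3 ℕ.<? 8) , λ S ∣S∣<3 u v u∉S v∉S →
  Reachable⇒Star (crown 4) 4 (reachableOff S ∣S∣<3 u v u∉S v∉S)
  where
  #V = Graph.finite (crown 4)

  -- Two vertices on one side both of whose common neighbours are removed are
  -- joined by a walk of length 4 but by no shorter one.
  reachableOff : ∀ S → length S < 3 → ReachableOff (crown 4) 4 S
  reachableOff [] _ = from-yes (reachableOff? (crown 4) 4 [])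
  reachableOff (x ∷ []) _ =
    from-yes (finite-all? #V λ x → reachableOff? (crown 4) 4 (x ∷ [])) x
  reachableOff (x ∷ y ∷ []) _ =
    from-yes (finite-all? #V λ x → finite-all? #V λ y →
      reachableOff? (crown 4) 4 (x ∷ y ∷ [])) x y
  reachableOff (_ ∷ _ ∷ _ ∷ _) (s≤s (s≤s (s≤s ())))

-- A spherical embedding of the crown graph

module _ where
  open Graph (crown 4) using (finite)
  open Dart

  -- Number the vertices of the cube so that antipodes share a number.  Around
  -- inj₁ i the neighbours follow the cyclic order j → k → l for which (i,j,k,l)
  -- is an even permutation of (0,1,2,3); the antipodal map reverses orientation,
  -- so around inj₂ i they follow the inverse order.
  turn : Fin 4 → Fin 4 → Fin 4
  turn i = lookup (lookup rows i)
    where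
    rows : Vec (Vec (Fin 4) 4) 4
    rows = (0F ∷ 2F ∷ 3F ∷ 1F ∷ [])
         ∷ (3F ∷ 1F ∷ 0F ∷ 2F ∷ [])
         ∷ (1F ∷ 3F ∷ 2F ∷ 0F ∷ [])
         ∷ (2F ∷ 0F ∷ 1F ∷ 3F ∷ []) ∷ []

  turn-≢ : ∀ i j → i ≢ j → i ≢ turn i j
  turn-≢ = from-yes (all? λ i → all? λ j → ¬? (i ≟F j) →-dec ¬? (i ≟F turn i j))

  rotate : Dart (crown 4) → Dart (crown 4)
  rotate (dart (inj₁ i) (inj₂ j) i≢j) = dart (inj₁ i) (inj₂ (turn i j)) (turn-≢ i j i≢j)
  -- `turn i` is a 3-cycle on the indices other than `i`, so its square is its inverse.
  rotate (dart (inj₂ i) (inj₁ j) i≢j) =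
    dart (inj₂ i) (inj₁ (turn i (turn i j))) (turn-≢ i _ (turn-≢ i j i≢j))

  rotate-injective : Injective _≡_ _≡_ rotate
  rotate-injective {d} {e} = from-yes
    (all-darts? λ d → all-darts? λ e → (rotate d ≟D rotate e) →-dec (d ≟D e)) d e

  tail-rotate : ∀ d → tail (rotate d) ≡ tail d
  tail-rotate (dart (inj₁ _) (inj₂ _) _) = refl
  tail-rotate (dart (inj₂ _) (inj₁ _) _) = refl

  Orbit? : ∀ n (f : Dart (crown 4) → Dart (crown 4)) d e →
           Dec (∃ λ (i : Fin n) → iterate f d (toℕ i) ≡ e)
  Orbit? n f d e = any? λ i → iterate f d (toℕ i) ≟D e

  faceStep : Dart (crown 4) → Dart (crown 4)
  faceStep d = rotate (reverse (crown 4) d)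

  -- A face meets the first side in two vertices, and distinct faces in distinct
  -- pairs; the diagonal entries are junk.
  pair : Fin 4 → Fin 4 → Fin 6
  pair i = lookup (lookup rows i)
    where
    rows : Vec (Vec (Fin 6) 4) 4
    rows = (0F ∷ 0F ∷ 1F ∷ 2F ∷ [])
         ∷ (0F ∷ 0F ∷ 3F ∷ 4F ∷ [])
         ∷ (1F ∷ 3F ∷ 0F ∷ 5F ∷ [])
         ∷ (2F ∷ 4F ∷ 5F ∷ 0F ∷ []) ∷ []

  -- The other first-side vertex of the face is the head of the next dart, or the tail of the
  -- preceding one; the latter inverts the square of `turn i`, which is `turn i` again.
  faceOf : Dart (crown 4) → Fin 6
  faceOf (dart (inj₁ i) (inj₂ j) _) = pair i (turn j (turn j i))
  faceOf (dart (inj₂ i) (inj₁ j) _) = pair j (turn i j)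

  -- An edge is numbered by its end on the first side and the rank of the other end among the three
  -- remaining indices.
  edgeOf : Dart (crown 4) → Fin 12
  edgeOf (dart (inj₁ i) (inj₂ j) i≢j) = combine i (Inverse.to (≢-size i) (j , [ i≢j ]))
  edgeOf (dart (inj₂ i) (inj₁ j) i≢j) = combine j (Inverse.to (≢-size j) (i , [ ≢-sym i≢j ]))

  surjective? : ∀ {n} (f : Dart (crown 4) → Fin n) → Dec (∀ i → ∃ λ d → f d ≡ i)
  surjective? f = all? λ i → any-dart? λ d → f d ≟F i

  crown₄-planar : Planar (crown 4)
  crown₄-planar = record
    { next           = rotate
    ; next-injective = rotate-injective
    ; next-cyclic    = λ d e → mk⇔
        -- All degrees are 3, so three iterates exhaust an orbit.
        (λ same → forget rotate (from-yes (all-darts? λ d → all-darts? λ e →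
          finite-≟ finite (tail d) (tail e) →-dec Orbit? 3 rotate d e) d e same))
        (Orbit-invariant rotate tail tail-rotate)
    ; vertices = record
        { class      = Inverse.to finite ∘ tail
        ; surjective = strictlySurjective⇒surjective (from-yes (surjective? (Inverse.to finite ∘ tail)))
        ; class-≡    = λ d e → mk⇔ (to-injective finite) (cong (Inverse.to finite))
        }
    ; edges = record
        { class      = edgeOf
        ; surjective = strictlySurjective⇒surjective (from-yes (surjective? edgeOf))
        ; class-≡    = λ d e → mk⇔
            (from-yes (all-darts? λ d → all-darts? λ e →
              (edgeOf d ≟F edgeOf e) →-dec ((d ≟D e) ⊎-dec (reverse (crown 4) d ≟D e))) d e)
            λ { (inj₁ refl) → refl
              ; (inj₂ refl) → sym (from-yes (all-darts? λ d →
                  edgeOf (reverse (crown 4) d) ≟F edgeOf d) d) }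
        }
    ; faces = record
        { class      = faceOf
        ; surjective = strictlySurjective⇒surjective (from-yes (surjective? faceOf))
        ; class-≡    = λ d e → mk⇔
            -- All faces are quadrilaterals, so four iterates exhaust an orbit.
            (λ same → forget faceStep (from-yes (all-darts? λ d → all-darts? λ e →
              (faceOf d ≟F faceOf e) →-dec Orbit? 4 faceStep d e) d e same))
            (Orbit-invariant faceStep faceOf
              (from-yes (all-darts? λ d → faceOf (faceStep d) ≟F faceOf d)))
        }
    ; components = record
        { class      = const {A = Fin 1} 0F
        ; surjective = λ { 0F → dart (inj₁ 0F) (inj₂ 1F) (λ ()) , λ _ → refl }
        ; class-≡    = λ d e → mk⇔
            -- Connectedness is 3-connectivity with nothing deleted.
            (λ _ → Star.map (proj₂ ∘ proj₂)
              (proj₂ crown₄-3-connected [] (s≤s z≤n) (tail d) (tail e) (λ ()) (λ ())))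
            (λ _ → refl)
        }
    -- 8 + 6 = 12 + 2.
    ; euler = refl
    }
    where
    forget : ∀ {n} (f : Dart (crown 4) → Dart (crown 4)) {d e} →
             (∃ λ (i : Fin n) → iterate f d (toℕ i) ≡ e) → Orbit f d e
    forget _ (i , eq) = toℕ i , eq

-- The crown graph as the cube

≅-trans : ∀ {U V W : Set} {G : Graph U} {H : Graph V} {K : Graph W} → G ≅ H → H ≅ K → G ≅ K
≅-trans (f , f-adj) (g , g-adj) =
  g ↔-∘ f , λ u v → g-adj (Inverse.to f u) (Inverse.to f v) ⇔-∘ f-adj u v

-- The first side receives the vectors of even weight, and `inj₂ i` the antipode of `inj₁ i`.
-- Vectors of opposite parity differ in one or three coordinates, and in three only when antipodal.
crown₄≅Q₃ : crown 4 ≅ Q₃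
crown₄≅Q₃ =
  mk↔ₛ′ to from to∘from from∘to , λ u v → mk⇔ (proj₁ (adjacent u v)) (proj₂ (adjacent u v))
  where
  to : Fin 4 ⊎ Fin 4 → Vec (Fin 2) 3
  to (inj₁ 0F) = 0F ∷ 0F ∷ 0F ∷ []
  to (inj₁ 1F) = 0F ∷ 1F ∷ 1F ∷ []
  to (inj₁ 2F) = 1F ∷ 0F ∷ 1F ∷ []
  to (inj₁ 3F) = 1F ∷ 1F ∷ 0F ∷ []
  to (inj₂ 0F) = 1F ∷ 1F ∷ 1F ∷ []
  to (inj₂ 1F) = 1F ∷ 0F ∷ 0F ∷ []
  to (inj₂ 2F) = 0F ∷ 1F ∷ 0F ∷ []
  to (inj₂ 3F) = 0F ∷ 0F ∷ 1F ∷ []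

  from : Vec (Fin 2) 3 → Fin 4 ⊎ Fin 4
  from (0F ∷ 0F ∷ 0F ∷ []) = inj₁ 0F
  from (0F ∷ 1F ∷ 1F ∷ []) = inj₁ 1F
  from (1F ∷ 0F ∷ 1F ∷ []) = inj₁ 2F
  from (1F ∷ 1F ∷ 0F ∷ []) = inj₁ 3F
  from (1F ∷ 1F ∷ 1F ∷ []) = inj₂ 0F
  from (1F ∷ 0F ∷ 0F ∷ []) = inj₂ 1F
  from (0F ∷ 1F ∷ 0F ∷ []) = inj₂ 2F
  from (0F ∷ 0F ∷ 1F ∷ []) = inj₂ 3F

  to∘from : ∀ x → to (from x) ≡ x
  to∘from = from-yes (finite-all? (Graph.finite Q₃) λ x →
    finite-≟ (Graph.finite Q₃) (to (from x)) x)

  from∘to : ∀ v → from (to v) ≡ v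
  from∘to = from-yes (finite-all? (Graph.finite (crown 4)) λ v →
    finite-≟ (Graph.finite (crown 4)) (from (to v)) v)

  adjacent : ∀ u v → (CrownAdjacent u v → hamming (to u) (to v) ≡ 1) ×
                     (hamming (to u) (to v) ≡ 1 → CrownAdjacent u v)
  adjacent = from-yes (
    finite-all? (Graph.finite (crown 4)) λ u → finite-all? (Graph.finite (crown 4)) λ v →
    (crownAdjacent? u v →-dec (hamming (to u) (to v) ℕ.≟ 1)) ×-dec
    ((hamming (to u) (to v) ℕ.≟ 1) →-dec crownAdjacent? u v))

cube-realization : (I : PreferenceStructure 4) → StrongRealization I
cube-realization I = record
  { graph        = crown 4
  ; sizeV-M      = ↔-id _
  ; sizeV-W      = ↔-id _
  ; independentM = λ _ _ ()
  ; independentW = λ _ _ ()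
  ; polyhedral   = crown₄-planar , crown₄-3-connected
  ; agentsM      = sizeM
  ; agentsW      = sizeW
  ; degreeM      = ≢-size
  ; degreeW      = ≢-size
  }
  where open PreferenceStructure I

-- Every strong realization is a crown graph

module _ {n} {I : PreferenceStructure (suc n)} (R : StrongRealization I) where
  open StrongRealization R

  private
    non-neighbourW : ∀ u → ∃ λ w → ¬ (inj₁ u ~ inj₂ w)
    non-neighbourW u = exception sizeV-W (λ w → inj₁ u ~? inj₂ w) (degreeM u)

    non-neighbourM : ∀ w → ∃ λ u → ¬ (inj₂ w ~ inj₁ u)
    non-neighbourM w = exception sizeV-M (λ u → inj₂ w ~? inj₁ u) (degreeW w)

    uniqueW : ∀ {u w w′} → ¬ (inj₁ u ~ inj₂ w) → ¬ (inj₁ u ~ inj₂ w′) → w ≡ w′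
    uniqueW {u} = exception-unique sizeV-W (λ w → inj₁ u ~? inj₂ w) (degreeM u)

    uniqueM : ∀ {w u u′} → ¬ (inj₂ w ~ inj₁ u) → ¬ (inj₂ w ~ inj₁ u′) → u ≡ u′
    uniqueM {w} = exception-unique sizeV-M (λ u → inj₂ w ~? inj₁ u) (degreeW w)

    partner : V-M → V-W
    partner = proj₁ ∘ non-neighbourW

    partner⁻¹ : V-W → V-M
    partner⁻¹ = proj₁ ∘ non-neighbourM

    -- Non-adjacency is symmetric, so uniqueness of the non-neighbour makes the two choices mutually
    -- inverse.
    partner-↔ : V-M ↔ V-W
    partner-↔ = mk↔ₛ′ partner partner⁻¹
      (λ w → uniqueW (proj₂ (non-neighbourW (partner⁻¹ w))) (proj₂ (non-neighbourM w) ∘ ~-sym))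
      (λ u → uniqueM (proj₂ (non-neighbourM (partner u))) (proj₂ (non-neighbourW u) ∘ ~-sym))

    adjacent⇔ : ∀ u w → (inj₁ u ~ inj₂ w) ⇔ (u ≢ partner⁻¹ w)
    adjacent⇔ u w = mk⇔ (λ { u~w refl → proj₂ (non-neighbourM w) (~-sym u~w) })
      λ u≢ → decidable-stable (inj₁ u ~? inj₂ w) λ u≁w →
        u≢ (uniqueM (u≁w ∘ ~-sym) (proj₂ (non-neighbourM w)))

    ≢-transport : ∀ {A B : Set} (f : A ↔ B) {x y} → (x ≢ y) ⇔ (Inverse.to f x ≢ Inverse.to f y)
    ≢-transport f = mk⇔ (_∘ to-injective f) (_∘ cong (Inverse.to f))

    ~-sym⇔ : ∀ {u v} → (u ~ v) ⇔ (v ~ u)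
    ~-sym⇔ = mk⇔ ~-sym ~-sym

    ≢-sym⇔ : ∀ {A : Set} {x y : A} → (x ≢ y) ⇔ (y ≢ x)
    ≢-sym⇔ = mk⇔ ≢-sym ≢-sym

  realization≅crown : graph ≅ crown (suc n)
  realization≅crown = index , adj
    where
    index : (V-M ⊎ V-W) ↔ (Fin (suc n) ⊎ Fin (suc n))
    -- Each vertex of `V-W` takes the index of its partner, so that the missing matching becomes
    -- equality of indices.
    index = sizeV-M ⊎-↔ (sizeV-M ↔-∘ ↔-sym partner-↔)

    adj : ∀ u v → (u ~ v) ⇔ CrownAdjacent (Inverse.to index u) (Inverse.to index v)
    adj (inj₁ u) (inj₁ v) = mk⇔ (independentM u v) λ ()
    adj (inj₂ u) (inj₂ v) = mk⇔ (independentW u v) λ ()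
    adj (inj₁ u) (inj₂ w) = ≢-transport sizeV-M ⇔-∘ adjacent⇔ u w
    adj (inj₂ w) (inj₁ u) = ≢-sym⇔ ⇔-∘ (adj (inj₁ u) (inj₂ w) ⇔-∘ ~-sym⇔)

-- Lower and upper bounds on k

two-distinct : ∀ {n} → 1 < n → ∃ λ (i : Fin n) → ∃ λ (j : Fin n) → i ≢ j
two-distinct {suc (suc _)} _        = 0F , 1F , λ ()
two-distinct {suc zero}    (s≤s ())

module _ {V : Set} {G : Graph V} where
  open Graph G

  -- The first step of a nonempty walk would enter `S`.
  walk-from-isolated : ∀ {S u v} → (∀ {w} → u ~ w → w ∈ S) → Star (Avoiding G S) u v → u ≡ v
  walk-from-isolated isolated ε                     = refl
  walk-from-isolated isolated ((_ , w∉S , u~w) ◅ _) = contradiction (isolated u~w) w∉S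

module _ {k} {I : PreferenceStructure k} (R : StrongRealization I) where
  open StrongRealization R
  open Dart

  order≡2k : order ≡ k + k
  order≡2k = ↔⇒≡ ((↔-sym +↔⊎ ↔-∘ (sizeV-M ⊎-↔ sizeV-W)) ↔-∘ ↔-sym finite)

  private
    dartsM : V-M → Fin (k ∸ 1) → Dart graph
    dartsM u i with Inverse.from (degreeM u) i
    ... | w , [ u~w ] = dart (inj₁ u) (inj₂ w) u~w

    dartsW : V-W → Fin (k ∸ 1) → Dart graph
    dartsW w i with Inverse.from (degreeW w) i
    ... | u , [ w~u ] = dart (inj₂ w) (inj₁ u) w~u

    dartsM-surjective : ∀ u {w} → inj₁ u ~ inj₂ w → ∃ λ i → head (dartsM u i) ≡ inj₂ w
    dartsM-surjective u u~w =
      _ , cong (inj₂ ∘ value) (Inverse.strictlyInverseʳ (degreeM u) (_ , [ u~w ]))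

    dartsM-injective : ∀ u {i j} → dartsM u i ≡ dartsM u j → i ≡ j
    dartsM-injective u eq = to-injective (↔-sym (degreeM u))
      (value-injective (inj₂-injective (cong head eq)))

    dartsW-injective : ∀ w {i j} → dartsW w i ≡ dartsW w j → i ≡ j
    dartsW-injective w eq = to-injective (↔-sym (degreeW w))
      (value-injective (inj₁-injective (cong head eq)))

    module P = Planar (proj₁ polyhedral)
    module E = Classes P.edges

  -- Darts leaving `V-M` lie on distinct edges, because the reverse of such a dart leaves `V-W`.
  edges-bound : k * (k ∸ 1) ≤ P.#edges
  edges-bound = injective⇒size≤ (↔-sym *↔×) (↔-id _) {edgeOfPair} inj
    where
    edgeOfPair : Fin k × Fin (k ∸ 1) → Fin P.#edges
    edgeOfPair (i , j) = E.class (dartsM (Inverse.from sizeV-M i) j)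
    inj : Injective _≡_ _≡_ edgeOfPair
    inj {i , j} {i′ , j′} eq with Equivalence.to (E.class-≡ _ _) eq
    ... | inj₂ ()
    ... | inj₁ same with refl ← to-injective (↔-sym sizeV-M) (inj₁-injective (cong tail same))
      = cong (i ,_) (dartsM-injective _ same)

  private
    colour : V-M ⊎ V-W → Bool
    colour = [ const true , const false ]′

    proper : ∀ {u v} → u ~ v → colour v ≡ not (colour u)
    proper {inj₁ u} {inj₁ v} u~v = contradiction u~v (independentM u v)
    proper {inj₁ _} {inj₂ _} _   = refl
    proper {inj₂ _} {inj₁ _} _   = refl
    proper {inj₂ u} {inj₂ v} u~v = contradiction u~v (independentW u v)

    no-leaf : 1 < k ∸ 1 → ∀ (d : Dart graph) → ¬ (∀ (e : Dart graph) → tail d ≡ tail e → d ≡ e)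
    no-leaf 1<deg (dart (inj₁ u) _ _) unique with i , j , i≢j ← two-distinct 1<deg =
      i≢j (dartsM-injective u (trans (sym (unique _ refl)) (unique _ refl)))
    no-leaf 1<deg (dart (inj₂ w) _ _) unique with i , j , i≢j ← two-distinct 1<deg =
      i≢j (dartsW-injective w (trans (sym (unique _ refl)) (unique _ refl)))

  realization⇒4≤k : 4 ≤ k
  realization⇒4≤k = ℕ.≮⇒≥ k≮4
    where
    -- 3-connectivity includes having more than three vertices. A second vertex of `V-M` is then
    -- available, to be separated from `u`.
    2≤k : 2 ≤ k
    2≤k = ℕ.*-cancelˡ-< 2 1 k (begin-strict
      2          <⟨ ℕ.m<n⇒m<1+n (ℕ.n<1+n 2) ⟩
      4          ≤⟨ proj₁ (proj₂ polyhedral) ⟩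
      order      ≡⟨ order≡2k ⟩
      k + k      ≡⟨ cong (k +_) (ℕ.+-identityʳ k) ⟨
      2 * k      ∎)
      where open ℕ.≤-Reasoning

    k≮4 : ¬ (k < 4)
    k≮4 k<4 with i , j , i≢j ← two-distinct 2≤k =
      i≢j (to-injective (↔-sym sizeV-M) (inj₁-injective
        (walk-from-isolated {G = graph} isolated
          (proj₂ (proj₂ polyhedral) S ∣S∣<3 (inj₁ u) (inj₁ _) inj₁∉S inj₁∉S))))
      where
      u : V-M
      u = Inverse.from sizeV-M i
      S : List (V-M ⊎ V-W)
      S = List.tabulate (head ∘ dartsM u)
      ∣S∣<3 : length S < 3
      -- Truncated subtraction stays strictly monotone here because `1 ≤ k`.
      ∣S∣<3 = subst (_< 3) (sym (List.length-tabulate _)) (ℕ.∸-monoˡ-< k<4 (ℕ.≤-trans (s≤s z≤n) 2≤k))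
      inj₁∉S : ∀ {u′} → inj₁ u′ ∉ S
      inj₁∉S u′∈S with () ← proj₂ (∈-tabulate⁻ u′∈S)
      isolated : ∀ {v} → inj₁ u ~ v → v ∈ S
      isolated {inj₁ v} u~v = contradiction u~v (independentM u v)
      isolated {inj₂ w} u~w with i , head≡ ← dartsM-surjective u u~w =
        subst (_∈ S) head≡ (∈-tabulate⁺ i)

  realization⇒k≤4 : k ≤ 4
  -- If `4 < k`, then `k ∸ 1` is at least 4, and the chain closes up to 4k < 4k, strict because of
  -- the 4 in Euler's bound.
  realization⇒k≤4 = ℕ.≮⇒≥ λ 4<k → ℕ.<-irrefl refl (begin-strict
    k * 4               ≤⟨ ℕ.*-monoʳ-≤ k (ℕ.∸-monoˡ-≤ 1 4<k) ⟩
    k * (k ∸ 1)         ≤⟨ edges-bound ⟩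
    P.#edges            <⟨ ℕ.m<m+n P.#edges (s≤s z≤n) ⟩
    P.#edges + 4        ≤⟨ bipartite-planar-bound (proj₁ polyhedral) colour proper
                             (no-leaf 1<deg) someDart ⟩
    2 * order           ≡⟨ cong (2 *_) order≡2k ⟩
    2 * (k + k)         ≡⟨ double k ⟩
    k * 4               ∎)
    where
    open ℕ.≤-Reasoning
    double : ∀ k → 2 * (k + k) ≡ k * 4
    double = solve-∀
    -- The lower bound `4 ≤ k` supplies what Euler's bound asks for: no leaves, and some dart.
    1<deg : 1 < k ∸ 1
    1<deg = ℕ.≤-trans (s≤s (s≤s z≤n)) (ℕ.∸-monoˡ-≤ 1 realization⇒4≤k)
    someDart : Dart graph
    someDart with i , _ ← two-distinct (ℕ.≤-trans (s≤s (s≤s z≤n)) realization⇒4≤k)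
                | j , _ ← two-distinct 1<deg = dartsM (Inverse.from sizeV-M i) j

theorem4p2 : (k : ℕ) → .{{_ : NonZero k}} → (I : PreferenceStructure k) →
    (StrongRealization I ⇔ k ≡ 4) ×
    (k ≡ 4 → (R : StrongRealization I) → StrongRealization.graph R ≅ Q₃)
theorem4p2 k I =
  mk⇔ (λ R → ℕ.≤-antisym (realization⇒k≤4 R) (realization⇒4≤k R))
      (λ { refl → cube-realization I }) ,
  λ { refl R → ≅-trans {G = StrongRealization.graph R} {crown 4} {Q₃} (realization≅crown R) crown₄≅Q₃ }
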